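{- Let $n,m$ be positive integers. If at least one of $n$ and $m$ is odd, then the first player wins the Peaceable Queens Game $\mathrm{PQ}(n,m)$.
   Context: The Peaceable Queens Game $\mathrm{PQ}(n,m)$ is played on an $n\times m$ chessboard with squares $(x,y)$, $0\leq x\leq n-1$, $0\leq y\leq m-1$. Two players alternately place a queen on an unoccupied square; the first player places white queens and the second player places black queens. A player may not place a queen on a square within attacking range of a queen previously placed by the opponent. A player unable to move on their turn loses. Two distinct squares $(x_1,y_1)$ and $(x_2,y_2)$ are within attacking range for queens iff $x_1=x_2$, or $y_1=y_2$, or $|x_1-x_2|=|y_1-y_2|$ (regardless of any pieces standing between them). A player "wins" the game if that player has a winning strategy. -}

module Defs where

open import Data.Fin.Base using (Fin; toℕ)
open import Data.List.Base using (List; []; _∷_)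
open import Data.List.Membership.Propositional using (_∈_; _∉_)
open import Data.Maybe.Base using (Maybe; just)
open import Data.Nat.Base using (ℕ; ∣_-_∣)
open import Data.Product.Base using (_×_; _,_; ∃)
open import Data.Sum.Base using (_⊎_)
open import Relation.Binary.PropositionalEquality.Core using (_≡_; _≢_)
open import Relation.Nullary.Negation.Core using (¬_)

data Player : Set where
  white black : Player

opponent : Player → Player
opponent white = black
opponent black = white

Square : ℕ → ℕ → Set
Square n m = Fin n × Fin m

Attacks : ∀ {n m} → Square n m → Square n m → Set
Attacks s₁@(x₁ , y₁) s₂@(x₂ , y₂) =
  s₁ ≢ s₂ ×
  (x₁ ≡ x₂ ⊎ y₁ ≡ y₂ ⊎ ∣ toℕ x₁ - toℕ x₂ ∣ ≡ ∣ toℕ y₁ - toℕ y₂ ∣)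

module PQ (n m : ℕ) where

  -- The queens placed so far, most recent first.
  History : Set
  History = List (Player × Square n m)

  Legal : Player → Square n m → History → Set
  Legal p s h =
    (∀ q → (q , s) ∉ h) ×
    (∀ t → (opponent p , t) ∈ h → ¬ Attacks s t)

  -- A strategy may be partial: `nothing` prescribes no move, and
  -- `follow` below demands a prescribed legal move at every turn of its user.
  Strategy : Set
  Strategy = History → Maybe (Square n m)

  -- WinningFrom p σ t h: with t to move after h, every play in which p moves
  -- according to σ and the opponent moves arbitrarily is finite and ends with
  -- the opponent unable to move.  Plays end only in `reply`, at histories where
  -- the opponent has no legal move and the quantification over s is vacuous.
  data WinningFrom (p : Player) (σ : Strategy) : Player → History → Set where
    follow : ∀ {t h s} → t ≡ p → σ h ≡ just s → Legal t s h →
             WinningFrom p σ (opponent t) ((t , s) ∷ h) →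
             WinningFrom p σ t h
    reply  : ∀ {t h} → t ≢ p →
             (∀ s → Legal t s h → WinningFrom p σ (opponent t) ((t , s) ∷ h)) →
             WinningFrom p σ t h

  -- White is the first player.
  Wins : Player → Set
  Wins p = ∃ λ σ → WinningFrom p σ white []

{-# OPTIONS --safe #-}
-- White opens in the middle of the board and then answers every black queen with
-- its image under the half-turn ρ.  The answer can fail only if black's square s
-- is attacked by ρ s (or equal to it, or to the image of the opening square), and
-- each such s shares a line with the opening queen: on an odd side of length n the
-- distance |x - ρ x| is twice the distance from x to the middle, and the parity of
-- |x - ρ x| is that of n - 1, so s and ρ s share a diagonal only if both sides are
-- odd or both even.
module Submission where

open import Defs
open import Data.Fin.Base using (Fin; zero; suc; toℕ; fromℕ<; combine; opposite)
open import Data.Fin.Properties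
  using (toℕ<n; toℕ-injective; toℕ-fromℕ<; opposite-prop; opposite-involutive;
         combine-injective; injective⇒≤)
open import Data.List.Base using (List; []; _∷_; length; lookup; map)
open import Data.List.Membership.Propositional using (_∈_)
open import Data.List.Membership.Propositional.Properties using (∈-map⁻; ∈-lookup)
open import Data.List.Properties using (length-map)
open import Data.List.Relation.Unary.All as All using ([])
open import Data.List.Relation.Unary.All.Properties using (¬Any⇒All¬)
open import Data.List.Relation.Unary.AllPairs using ([]; _∷_)
open import Data.List.Relation.Unary.Any using (here; there)
open import Data.List.Relation.Unary.Unique.Propositional using (Unique)
open import Data.List.Relation.Unary.Unique.Propositional.Properties using (map⁺)
open import Data.Maybe.Base using (just)
open import Data.Nat.Base
  using (ℕ; zero; suc; _+_; _*_; _≤_; _<_; s≤s; z≤n; ∣_-_∣; _⊓_; _/_; _%_; NonZero)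
open import Data.Nat.DivMod using (m≡m%n+[m/n]*n; [m+kn]%n≡m%n; m/n<m)
open import Data.Nat.Properties
  using (+-comm; +-suc; +-identityʳ; *-distribʳ-∣-∣; m+[n∸m]≡n;
         ∣-∣-comm; ∣m+n-m+o∣≡∣n-o∣; ∣m-n∣≡0⇒m≡n; m≡n⇒∣m-n∣≡0; m*n≡0⇒m≡0;
         *-cancelʳ-≡; <⇒≱; suc-injective; ∣n-n∣≡0;
         ≤-refl; ≤-reflexive; ≤-trans; m≤n⇒m≤1+n)
open import Data.Nat.Solver using (module +-*-Solver)
open import Data.Product.Base using (_×_; _,_; proj₁; proj₂; uncurry)
open import Data.Sum.Base using (_⊎_; inj₁; inj₂)
open import Function.Base using (_∘_)
open import Relation.Binary.PropositionalEquality
open import Relation.Nullary.Negation using (¬_; contradiction)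

-- Counting distinct squares

unique-lookup-injective : ∀ {a} {A : Set a} {xs : List A} → Unique xs →
  ∀ {i j} → lookup xs i ≡ lookup xs j → i ≡ j
unique-lookup-injective (x∉ ∷ u) {zero}  {zero}  eq = refl
unique-lookup-injective (x∉ ∷ u) {zero}  {suc j} eq =
  contradiction eq (All.lookup x∉ (∈-lookup j))
unique-lookup-injective (x∉ ∷ u) {suc i} {zero}  eq =
  contradiction (sym eq) (All.lookup x∉ (∈-lookup i))
unique-lookup-injective (x∉ ∷ u) {suc i} {suc j} eq =
  cong suc (unique-lookup-injective u eq)

-- Pigeonhole: `lookup` on a duplicate-free list is injective, and `combine` embeds the squares into
-- `Fin (n * m)`.
unique-squares-length : ∀ {n m} {ss : List (Square n m)} → Unique ss → length ss ≤ n * m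
unique-squares-length {ss = ss} u =
  subst (_≤ _) (length-map (uncurry combine) ss)
    (injective⇒≤ (unique-lookup-injective (map⁺ combine-inj u)))
  where
  combine-inj : ∀ {s t} → uncurry combine s ≡ uncurry combine t → s ≡ t
  combine-inj {x , y} {x′ , y′} eq with refl , refl ← combine-injective x y x′ y′ eq = refl

-- Attack without distinctness. Being reflexive, it treats a coincidence of squares and an attack as
-- one obstacle.
SharesLine : ∀ {n m} → Square n m → Square n m → Set
SharesLine (x₁ , y₁) (x₂ , y₂) =
  x₁ ≡ x₂ ⊎ y₁ ≡ y₂ ⊎ ∣ toℕ x₁ - toℕ x₂ ∣ ≡ ∣ toℕ y₁ - toℕ y₂ ∣

sharesLine-reflexive : ∀ {n m} {s t : Square n m} → s ≡ t → SharesLine s t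
sharesLine-reflexive refl = inj₁ refl

sharesLine-sym : ∀ {n m} {s t : Square n m} → SharesLine s t → SharesLine t s
sharesLine-sym (inj₁ eq)        = inj₁ (sym eq)
sharesLine-sym (inj₂ (inj₁ eq)) = inj₂ (inj₁ (sym eq))
sharesLine-sym {s = x , y} {x′ , y′} (inj₂ (inj₂ eq)) = inj₂ (inj₂
  (trans (∣-∣-comm (toℕ x′) (toℕ x)) (trans eq (∣-∣-comm (toℕ y) (toℕ y′)))))

-- The mirroring strategy for an involution of the board

module Mirroring {n m : ℕ} (s₀ : Square n m) (ρ : Square n m → Square n m)
  (ρ-involutive : ∀ s → ρ (ρ s) ≡ s)
  (ρ-sharesLine : ∀ {s t} → SharesLine s t → SharesLine (ρ s) (ρ t))
  (sharesLine-s₀ : ∀ s → SharesLine s (ρ s) → SharesLine s s₀)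
  -- Keeps black off `ρ s₀`, whose mirror answer would be the occupied `s₀`; `s₀` need not be fixed
  -- by `ρ`.
  (s₀-ρs₀ : SharesLine s₀ (ρ s₀))
  where

  open PQ n m

  mirror : Strategy
  mirror []            = just s₀
  mirror ((_ , s) ∷ _) = just (ρ s)

  -- Histories at black's turns when white plays `mirror`. Only the pairing of queens is recorded;
  -- distinctness of the squares is tracked separately.
  data Mirrored : History → Set where
    opening : Mirrored ((white , s₀) ∷ [])
    round   : ∀ {s h} → Mirrored h → Mirrored ((white , ρ s) ∷ (black , s) ∷ h)

  s₀-white : ∀ {h} → Mirrored h → (white , s₀) ∈ h
  s₀-white opening   = here refl
  s₀-white (round M) = there (there (s₀-white M))

  black⇒ρ-white : ∀ {h t} → Mirrored h → (black , t) ∈ h → (white , ρ t) ∈ h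
  black⇒ρ-white opening   (here ())
  black⇒ρ-white opening   (there ())
  black⇒ρ-white (round M) (there (here refl)) = here refl
  black⇒ρ-white (round M) (there (there t∈))  = there (there (black⇒ρ-white M t∈))

  white⇒ρ-black : ∀ {h t} → Mirrored h → (white , t) ∈ h → t ≡ s₀ ⊎ (black , ρ t) ∈ h
  white⇒ρ-black opening   (here refl) = inj₁ refl
  white⇒ρ-black (round M) (here refl) = inj₂ (there (here (cong (black ,_) (ρ-involutive _))))
  white⇒ρ-black (round M) (there (there t∈)) with white⇒ρ-black M t∈
  ... | inj₁ eq  = inj₁ eq
  ... | inj₂ ρt∈ = inj₂ (there (there ρt∈))

  legal⇒¬sharesLine : ∀ {p s t h} → Legal p s h → (opponent p , t) ∈ h → ¬ SharesLine s t
  legal⇒¬sharesLine (free , safe) t∈ line = safe _ t∈ ((λ { refl → free _ t∈ }) , line)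

  -- An earlier queen obstructing `ρ s` has a mirror image obstructing `s`, against the legality of
  -- black's move. The queens not covered by this are the opening one and the one just placed on
  -- `s`.
  mirror-legal : ∀ {h s} → Mirrored h → Legal black s h → Legal white (ρ s) ((black , s) ∷ h)
  mirror-legal {h} {s} M legal = free , safe
    where
    ¬s-s₀ : ¬ SharesLine s s₀
    ¬s-s₀ = legal⇒¬sharesLine legal (s₀-white M)

    ¬s-ρs : ¬ SharesLine s (ρ s)
    ¬s-ρs = ¬s-s₀ ∘ sharesLine-s₀ s

    free : ∀ q → ¬ (q , ρ s) ∈ (black , s) ∷ h
    free q     (here eq)  = ¬s-ρs (sharesLine-reflexive (sym (cong proj₂ eq)))
    free black (there ∈h) =
      proj₁ legal white (subst (λ t → (white , t) ∈ h) (ρ-involutive s) (black⇒ρ-white M ∈h))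
    free white (there ∈h) with white⇒ρ-black M ∈h
    ... | inj₁ ρs≡s₀ = ¬s-s₀ (subst (λ t → SharesLine t s₀)
                         (trans (cong ρ (sym ρs≡s₀)) (ρ-involutive s)) (sharesLine-sym s₀-ρs₀))
    ... | inj₂ ρρs∈  =
      proj₁ legal black (subst (λ t → (black , t) ∈ h) (ρ-involutive s) ρρs∈)

    safe : ∀ t → (black , t) ∈ (black , s) ∷ h → ¬ Attacks (ρ s) t
    safe t (here refl) (_ , line) = ¬s-ρs (sharesLine-sym line)
    safe t (there t∈)  (_ , line) = legal⇒¬sharesLine legal (black⇒ρ-white M t∈)
      (subst (λ u → SharesLine u (ρ t)) (ρ-involutive s) (ρ-sharesLine line))

  squares : History → List (Square n m)
  squares = map proj₂

  legal⇒unique : ∀ {p s h} → Legal p s h → Unique (squares h) → Unique (s ∷ squares h)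
  legal⇒unique {s = s} {h} (free , _) u = ¬Any⇒All¬ _ s∉ ∷ u
    where
    s∉ : ¬ s ∈ squares h
    s∉ s∈ with (q , _) , ∈h , refl ← ∈-map⁻ proj₂ s∈ = free q ∈h

  -- k bounds the number of rounds left, since no square is ever used twice.
  mirror-winningFrom : ∀ k {h} → Mirrored h → Unique (squares h) →
    n * m < k + length (squares h) → WinningFrom white mirror black h
  mirror-winningFrom zero    M u bound = contradiction (unique-squares-length u) (<⇒≱ bound)
  mirror-winningFrom (suc k) {h} M u bound = reply (λ ()) λ s legal →
    let legal′ = mirror-legal M legal in
    follow refl refl legal′
      (mirror-winningFrom k (round M) (legal⇒unique legal′ (legal⇒unique legal u))
        bound′)
    where
    -- A round adds two squares while `k` drops by one, so the bound gains one.
    bound′ : n * m < k + suc (suc (length (squares h)))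
    bound′ = ≤-trans (m≤n⇒m≤1+n bound) (≤-reflexive (sym
      (trans (+-suc k _) (cong suc (+-suc k _)))))

  mirror-wins : Wins white
  mirror-wins = mirror , follow refl refl ((λ _ ()) , (λ _ ()))
    (mirror-winningFrom (n * m) opening ([] ∷ []) bound)
    where
    -- The opening queen supplies the 1 that makes the inequality strict.
    bound : n * m < n * m + 1
    bound = subst (n * m <_) (+-comm 1 (n * m)) ≤-refl

-- Distances and parity under reflection of one side

suc-toℕ+opposite : ∀ {n} (i : Fin n) → suc (toℕ i + toℕ (opposite i)) ≡ n
suc-toℕ+opposite i =
  trans (cong (suc (toℕ i) +_) (opposite-prop i)) (m+[n∸m]≡n (toℕ<n i))

-- Shifting `a` and `b` by `a′` turns the first into the common sum `b + b′`, from which `b`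
-- cancels; no truncated subtraction occurs.
∣-∣-complement : ∀ a {a′} b {b′} → a + a′ ≡ b + b′ → ∣ a - b ∣ ≡ ∣ a′ - b′ ∣
∣-∣-complement a {a′} b {b′} eq = begin
  ∣ a - b ∣            ≡⟨ ∣m+n-m+o∣≡∣n-o∣ a′ a b ⟨
  ∣ a′ + a - a′ + b ∣  ≡⟨ cong₂ ∣_-_∣ (trans (+-comm a′ a) eq) (+-comm a′ b) ⟩
  ∣ b + b′ - b + a′ ∣  ≡⟨ ∣m+n-m+o∣≡∣n-o∣ b b′ a′ ⟩
  ∣ b′ - a′ ∣          ≡⟨ ∣-∣-comm b′ a′ ⟩
  ∣ a′ - b′ ∣          ∎
  where open ≡-Reasoning

∣opposite-opposite∣ : ∀ {n} (i j : Fin n) →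
  ∣ toℕ (opposite i) - toℕ (opposite j) ∣ ≡ ∣ toℕ i - toℕ j ∣
∣opposite-opposite∣ i j = sym (∣-∣-complement (toℕ i) (toℕ j)
  (suc-injective (trans (suc-toℕ+opposite i) (sym (suc-toℕ+opposite j)))))

m+n≡∣m-n∣+[m⊓n]*2 : ∀ m n → m + n ≡ ∣ m - n ∣ + (m ⊓ n) * 2
m+n≡∣m-n∣+[m⊓n]*2 zero    n       = sym (+-identityʳ n)
m+n≡∣m-n∣+[m⊓n]*2 (suc m) zero    = refl
m+n≡∣m-n∣+[m⊓n]*2 (suc m) (suc n) = begin
  suc m + suc n                        ≡⟨ cong suc (+-suc m n) ⟩
  2 + (m + n)                          ≡⟨ cong (2 +_) (m+n≡∣m-n∣+[m⊓n]*2 m n) ⟩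
  2 + (∣ m - n ∣ + (m ⊓ n) * 2)        ≡⟨ solve 2 (λ a b → con 2 :+ (a :+ b) := a :+ (con 2 :+ b)) refl
                                             ∣ m - n ∣ ((m ⊓ n) * 2) ⟩
  ∣ m - n ∣ + (2 + (m ⊓ n) * 2)        ∎
  where open ≡-Reasoning; open +-*-Solver

-- The two indices add up to n - 1, and a sum has the parity of the corresponding distance.
∣-opposite∣-parity : ∀ {n} (i : Fin n) → n % 2 ≡ suc ∣ toℕ i - toℕ (opposite i) ∣ % 2
∣-opposite∣-parity {n} i = begin
  n % 2                                       ≡⟨ cong (_% 2) (suc-toℕ+opposite i) ⟨
  suc (a + b) % 2                             ≡⟨ cong (λ k → suc k % 2) (m+n≡∣m-n∣+[m⊓n]*2 a b) ⟩
  (suc ∣ a - b ∣ + (a ⊓ b) * 2) % 2           ≡⟨ [m+kn]%n≡m%n (suc ∣ a - b ∣) (a ⊓ b) 2 ⟩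
  suc ∣ a - b ∣ % 2                           ∎
  where
  open ≡-Reasoning
  a = toℕ i
  b = toℕ (opposite i)

n/2<n : ∀ n .{{_ : NonZero n}} → n / 2 < n
n/2<n n = m/n<m n 2 (s≤s (s≤s z≤n))

-- The centre for odd `n`; for even `n` the upper of the two central indices, which `opposite`
-- exchanges.
middle : ∀ n → .{{_ : NonZero n}} → Fin n
middle n = fromℕ< (n/2<n n)

∣-opposite∣-odd : ∀ n .{{_ : NonZero n}} → n % 2 ≡ 1 → (i : Fin n) →
  ∣ toℕ i - toℕ (opposite i) ∣ ≡ ∣ toℕ i - toℕ (middle n) ∣ * 2
∣-opposite∣-odd n odd i = begin
  -- The shift by `suc a` makes the second term `suc a + b`, which is `n`.
  ∣ a - b ∣                        ≡⟨ ∣m+n-m+o∣≡∣n-o∣ (suc a) a b ⟨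
  ∣ suc a + a - suc a + b ∣        ≡⟨ cong₂ (λ k l → ∣ suc k - l ∣) (double a) 1+a+b≡1+c*2 ⟩
  ∣ a * 2 - c * 2 ∣                ≡⟨ *-distribʳ-∣-∣ 2 a c ⟨
  ∣ a - c ∣ * 2                    ≡⟨ cong (λ k → ∣ a - k ∣ * 2) (toℕ-fromℕ< (n/2<n n)) ⟨
  ∣ a - toℕ (middle n) ∣ * 2       ∎
  where
  open ≡-Reasoning
  a = toℕ i
  b = toℕ (opposite i)
  c = n / 2
  double : ∀ k → k + k ≡ k * 2
  double = solve 1 (λ k → k :+ k := k :* con 2) refl
    where open +-*-Solver
  1+a+b≡1+c*2 : suc a + b ≡ suc (c * 2)
  1+a+b≡1+c*2 = trans (suc-toℕ+opposite i)
    (trans (m≡m%n+[m/n]*n n 2) (cong (_+ c * 2) odd))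

-- Oddness of `n` is not assumed: a fixed index has distance 0 from its opposite, which forces it by
-- parity.
self-opposite⇒middle : ∀ n .{{_ : NonZero n}} {i : Fin n} → i ≡ opposite i → i ≡ middle n
self-opposite⇒middle n {i} i≡i′ = toℕ-injective (∣m-n∣≡0⇒m≡n
  (m*n≡0⇒m≡0 _ 2 (trans (sym (∣-opposite∣-odd n odd i)) dist≡0)))
  where
  dist≡0 : ∣ toℕ i - toℕ (opposite i) ∣ ≡ 0
  dist≡0 = m≡n⇒∣m-n∣≡0 (cong toℕ i≡i′)
  odd : n % 2 ≡ 1
  odd = trans (∣-opposite∣-parity i) (cong (λ d → suc d % 2) dist≡0)

middle-self-opposite : ∀ n .{{_ : NonZero n}} → n % 2 ≡ 1 → middle n ≡ opposite (middle n)
middle-self-opposite n odd = toℕ-injective (∣m-n∣≡0⇒m≡n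
  (trans (∣-opposite∣-odd n odd (middle n)) (cong (_* 2) (∣n-n∣≡0 (toℕ (middle n))))))

-- The half-turn of the board

halfTurn : ∀ {n m} → Square n m → Square n m
halfTurn (x , y) = opposite x , opposite y

halfTurn-involutive : ∀ {n m} (s : Square n m) → halfTurn (halfTurn s) ≡ s
halfTurn-involutive (x , y) = cong₂ _,_ (opposite-involutive x) (opposite-involutive y)

halfTurn-sharesLine : ∀ {n m} {s t : Square n m} →
  SharesLine s t → SharesLine (halfTurn s) (halfTurn t)
halfTurn-sharesLine (inj₁ eq)        = inj₁ (cong opposite eq)
halfTurn-sharesLine (inj₂ (inj₁ eq)) = inj₂ (inj₁ (cong opposite eq))
halfTurn-sharesLine {s = x , y} {x′ , y′} (inj₂ (inj₂ eq)) = inj₂ (inj₂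
  (trans (∣opposite-opposite∣ x x′) (trans eq (sym (∣opposite-opposite∣ y y′)))))

both-odd : ∀ {a b} → a ≡ b → a ≡ 1 ⊎ b ≡ 1 → a ≡ 1 × b ≡ 1
both-odd refl (inj₁ eq) = eq , eq
both-odd refl (inj₂ eq) = eq , eq

sharesLine-halfTurn⇒middle : ∀ n m .{{_ : NonZero n}} .{{_ : NonZero m}} →
  n % 2 ≡ 1 ⊎ m % 2 ≡ 1 → (s : Square n m) →
  SharesLine s (halfTurn s) → SharesLine s (middle n , middle m)
sharesLine-halfTurn⇒middle n m odd s (inj₁ eq)        = inj₁ (self-opposite⇒middle n eq)
sharesLine-halfTurn⇒middle n m odd s (inj₂ (inj₁ eq)) = inj₂ (inj₁ (self-opposite⇒middle m eq))
sharesLine-halfTurn⇒middle n m odd (x , y) (inj₂ (inj₂ eq))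
  -- Equal distances along the two sides give `n` and `m` the same parity, so one odd side makes
  -- both odd. Each distance is then twice that to the middle, and the factor 2 cancels.
  with n-odd , m-odd ← both-odd
    (trans (∣-opposite∣-parity x)
      (trans (cong (λ d → suc d % 2) eq) (sym (∣-opposite∣-parity y)))) odd
  = inj₂ (inj₂ (*-cancelʳ-≡ _ _ 2
      (trans (sym (∣-opposite∣-odd n n-odd x)) (trans eq (∣-opposite∣-odd m m-odd y)))))

-- The half-turn fixes the middle coordinate of an odd side, whatever the parity of the other.
middle-sharesLine-halfTurn : ∀ n m .{{_ : NonZero n}} .{{_ : NonZero m}} →
  n % 2 ≡ 1 ⊎ m % 2 ≡ 1 → SharesLine (middle n , middle m) (halfTurn (middle n , middle m))
middle-sharesLine-halfTurn n m (inj₁ odd) = inj₁ (middle-self-opposite n odd)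
middle-sharesLine-halfTurn n m (inj₂ odd) = inj₂ (inj₁ (middle-self-opposite m odd))

theorem5p5 : (n m : ℕ) → .{{_ : NonZero n}} → .{{_ : NonZero m}} →
    n % 2 ≡ 1 ⊎ m % 2 ≡ 1 → PQ.Wins n m white
theorem5p5 n m odd = Mirroring.mirror-wins (middle n , middle m) halfTurn
  halfTurn-involutive halfTurn-sharesLine
  (sharesLine-halfTurn⇒middle n m odd) (middle-sharesLine-halfTurn n m odd)
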